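{- Let $k,n,m\ge 1$ be integers and let $K_{n,m}$ be the complete bipartite graph with parts of sizes $n$ and $m$. If the vertices of $K_{n,m}$ are colored uniformly and independently with $k$ colors, the expected number of blocks is $$\mathbb{E}[X_k(K_{n,m})] =\frac{nk^n(k-1)^m+mk^m(k-1)^n+k(k^n-(k-1)^n)(k^m-(k-1)^m)}{k^{n+m}}.$$
   Context: Given a coloring of the vertices of a finite graph $G$ with $k$ colors, the blocks are the connected components of the subgraph of $G$ formed by all vertices and all edges whose two endpoints have the same color. $X_k(G)$ denotes the number of blocks when each vertex of $G$ receives independently a uniformly random color among $k$ colors. -}

module Defs where

open import Data.Bool.Properties using () renaming (_≟_ to _≟ᵇ_)
open import Data.Empty using (⊥)
open import Data.Fin.Base using (Fin; zero; suc; splitAt; finToFun)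
open import Data.Fin.Properties using (any?) renaming (_≟_ to _≟ᶠ_)
open import Data.Fin.Subset using (Subset)
open import Data.Integer.Base using (+_)
open import Data.List.Base using (List; length; map; deduplicate; allFin)
open import Data.Nat.Base using (ℕ; zero; suc; _+_; _^_; NonZero)
open import Data.Nat.ListAction using (sum)
open import Data.Nat.Properties using (m^n≢0)
open import Data.Product.Base using (∃; _×_; _,_)
open import Data.Rational.Base using (ℚ; _/_)
open import Data.Sum.Base using (_⊎_; inj₁; inj₂)
open import Data.Unit.Base using (⊤; tt)
open import Data.Vec.Base using (tabulate)
open import Data.Vec.Properties using (≡-dec)
open import Level using (0ℓ)
open import Relation.Binary.Core using (Rel)
open import Relation.Binary.Definitions using (Decidable; Symmetric; Irreflexive)
open import Relation.Binary.Construct.Closure.ReflexiveTransitive using (Star; ε; _◅_; _◅◅_)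
open import Relation.Binary.PropositionalEquality.Core using (_≡_; refl; sym)
open import Relation.Nullary.Decidable.Core using (yes; no; does; map′; _×-dec_; _⊎-dec_)

record Graph (N : ℕ) : Set₁ where
  field
    Adj    : Rel (Fin N) 0ℓ
    adj?   : Decidable Adj
    symm   : Symmetric Adj
    irrefl : Irreflexive _≡_ Adj

-- Reachability in a finite decidable relation is decided by eliminating the
-- vertex zero, replacing each path u → zero → v by a direct step u → v.
module _ {N : ℕ} (R : Rel (Fin (suc N)) 0ℓ) where

  Bypass : Rel (Fin N) 0ℓ
  Bypass u v = R (suc u) (suc v) ⊎ (R (suc u) zero × R zero (suc v))

  bypass⇒star : ∀ {u v} → Star Bypass u v → Star R (suc u) (suc v)
  bypass⇒star ε                    = ε
  bypass⇒star (inj₁ r ◅ p)         = r ◅ bypass⇒star p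
  bypass⇒star (inj₂ (r , s) ◅ p)   = r ◅ s ◅ bypass⇒star p

  star⇒bypass : ∀ {u v} → Star R (suc u) (suc v) → Star Bypass u v
  leave-zero  : ∀ {v} → Star R zero (suc v) → ∃ λ w → R zero (suc w) × Star Bypass w v

  star⇒bypass ε                    = ε
  star⇒bypass (_◅_ {j = suc _} r p) = inj₁ r ◅ star⇒bypass p
  star⇒bypass (_◅_ {j = zero} r p) with leave-zero p
  ... | _ , s , q = inj₂ (r , s) ◅ q

  leave-zero (_◅_ {j = zero} _ p)  = leave-zero p
  leave-zero (_◅_ {j = suc w} r p) = w , r , star⇒bypass p

  enter-zero : ∀ {u} → Star R (suc u) zero → ∃ λ w → Star Bypass u w × R (suc w) zero
  enter-zero {u} (_◅_ {j = zero} r _) = u , ε , r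
  enter-zero (_◅_ {j = suc _} r p) with enter-zero p
  ... | w , q , s = w , inj₁ r ◅ q , s

star? : ∀ {N} {R : Rel (Fin N) 0ℓ} → Decidable R → Decidable (Star R)
star? {suc N} {R} R? = dec
  where
  bypass? : Decidable (Star (Bypass R))
  bypass? = star? λ u v → R? (suc u) (suc v) ⊎-dec (R? (suc u) zero ×-dec R? zero (suc v))

  dec : Decidable (Star R)
  dec zero    zero    = yes ε
  dec zero    (suc v) = map′ (λ (w , r , p) → r ◅ bypass⇒star R p) (leave-zero R)
                             (any? λ w → R? zero (suc w) ×-dec bypass? w v)
  dec (suc u) zero    = map′ (λ (w , p , r) → bypass⇒star R p ◅◅ (r ◅ ε)) (enter-zero R)
                             (any? λ w → bypass? u w ×-dec R? (suc w) zero)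
  dec (suc u) (suc v) = map′ (bypass⇒star R) (star⇒bypass R) (bypass? u v)

module _ {N : ℕ} (G : Graph N) where
  open Graph G

  Connected : Rel (Fin N) 0ℓ
  Connected = Star Adj

  connected? : Decidable Connected
  connected? = star? adj?

  component : Fin N → Subset N
  component v = tabulate λ u → does (connected? v u)

  components : List (Subset N)
  components = deduplicate (≡-dec _≟ᵇ_) (map component (allFin N))

Coloring : ℕ → ℕ → Set
Coloring k N = Fin N → Fin k

monochromatic : ∀ {k N} → Graph N → Coloring k N → Graph N
monochromatic G χ = record
  { Adj    = λ u v → Adj u v × χ u ≡ χ v
  ; adj?   = λ u v → adj? u v ×-dec (χ u ≟ᶠ χ v)
  ; symm   = λ (a , e) → symm a , sym e
  ; irrefl = λ u≡v (a , _) → irrefl u≡v a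
  }
  where open Graph G

blocks : ∀ {k N} → Graph N → Coloring k N → List (Subset N)
blocks G χ = components (monochromatic G χ)

-- X k G is the random variable X_k(G) on the sample space of colorings.
X : ∀ {N} (k : ℕ) → Graph N → Coloring k N → ℕ
X k G χ = length (blocks G χ)

-- finToFun is a bijection from Fin (k ^ N) onto the colorings, so each
-- coloring is listed exactly once (up to pointwise equality).
colorings : ∀ k N → List (Coloring k N)
colorings k N = map finToFun (allFin (k ^ N))

-- Independent uniform colors at the vertices: each of the k ^ N colorings
-- has probability 1 / k ^ N.
𝔼 : ∀ {k N} .{{_ : NonZero k}} → (Coloring k N → ℕ) → ℚ
𝔼 {k} {N} Y = _/_ (+ sum (map Y (colorings k N))) (k ^ N) {{m^n≢0 k N}}

-- In K n m the first n vertices form one part and the last m the other.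
module _ {n m : ℕ} where

  Opposite : Rel (Fin n ⊎ Fin m) 0ℓ
  Opposite (inj₁ _) (inj₁ _) = ⊥
  Opposite (inj₁ _) (inj₂ _) = ⊤
  Opposite (inj₂ _) (inj₁ _) = ⊤
  Opposite (inj₂ _) (inj₂ _) = ⊥

  opposite? : Decidable Opposite
  opposite? (inj₁ _) (inj₁ _) = no λ ()
  opposite? (inj₁ _) (inj₂ _) = yes tt
  opposite? (inj₂ _) (inj₁ _) = yes tt
  opposite? (inj₂ _) (inj₂ _) = no λ ()

  opposite-sym : ∀ x y → Opposite x y → Opposite y x
  opposite-sym (inj₁ _) (inj₂ _) _ = tt
  opposite-sym (inj₂ _) (inj₁ _) _ = tt

  opposite-irrefl : ∀ x → Opposite x x → ⊥
  opposite-irrefl (inj₁ _) ()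
  opposite-irrefl (inj₂ _) ()

K : ∀ n m → Graph (n + m)
K n m = record
  { Adj    = λ u v → Opposite (splitAt n u) (splitAt n v)
  ; adj?   = λ u v → opposite? (splitAt n u) (splitAt n v)
  ; symm   = λ {u} {v} → opposite-sym (splitAt n u) (splitAt n v)
  ; irrefl = λ { {u} refl → opposite-irrefl (splitAt n u) }
  }

{-# OPTIONS --safe #-}
-- A vertex of K n m whose color does not occur in the opposite part is a block
-- by itself, while the vertices of a color occurring in both parts form a
-- single block.  Hence the number of blocks is the number of vertices of the
-- first kind plus the number of colors occurring in both parts.  Summing over
-- the colorings α and β of the two parts, each color is missed by (k - 1) ^ m
-- of the k ^ m colorings β, whatever the color is.
module Submission where

open import Defs
import Algebra.Properties.Semiring.Sum as ∑
open import Data.Bool.Base using (true; false; if_then_else_)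
open import Data.Bool.Properties using () renaming (_≟_ to _≟ᵇ_)
open import Data.Fin.Base using (Fin; zero; suc; _↑ˡ_; _↑ʳ_; splitAt; join; combine; finToFun)
open import Data.Fin.Properties using (any?; injective⇒≤; remQuot-combine; splitAt-join; join-splitAt) renaming (_≟_ to _≟ᶠ_)
open import Data.Integer.Base using (+_; 1ℤ; _+_; _-_; _*_; _^_)
open import Data.Integer.Properties using (pos-*; m-n≡m⊖n; ⊖-≥)
open import Data.List.Base as List using (List; _++_; length; filter; allFin)
open import Data.List.Membership.Propositional using (_∈_)
open import Data.List.Membership.Propositional.Properties
open import Data.List.Properties using (length-++; length-map; map-tabulate)
open import Data.List.Relation.Unary.All as All using ()
open import Data.List.Relation.Unary.AllPairs using (_∷_)
open import Data.List.Relation.Unary.Any using (index)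
open import Data.List.Relation.Unary.Any.Properties using (lookup-index)
open import Data.List.Relation.Unary.Unique.DecPropositional.Properties using (deduplicate-!)
open import Data.List.Relation.Unary.Unique.Propositional using (Unique)
open import Data.List.Relation.Unary.Unique.Propositional.Properties using (map⁺; ++⁺; filter⁺; allFin⁺)
open import Data.Nat.Base as ℕ using (ℕ; zero; suc; NonZero; _∸_; _≤_)
open import Data.Nat.ListAction using () renaming (sum to sumᴸ)
open import Data.Nat.Properties as ℕ using (m^n≢0)
open import Data.Nat.Tactic.RingSolver using (solve-∀)
open import Data.Product.Base using (∃; _×_; _,_; proj₁; proj₂)
open import Data.Rational.Base using (_/_)
open import Data.Sum.Base using (_⊎_; inj₁; inj₂)
open import Data.Unit.Base using (tt)
open import Data.Vec.Base as Vec using ()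
open import Data.Vec.Functional as Vector using (Vector)
open import Data.Vec.Properties using (≡-dec; lookup∘tabulate; tabulate-cong)
open import Function.Base using (id; _∘_; case_of_)
open import Function.Bundles using (mk⇔)
open import Relation.Binary.Construct.Closure.ReflexiveTransitive using (ε; _◅_; _◅◅_; reverse; gfold)
open import Relation.Binary.PropositionalEquality.Core using (_≡_; _≗_; refl; sym; trans; cong; cong₂; subst; subst₂)
open import Relation.Binary.PropositionalEquality.Properties using (module ≡-Reasoning)
open import Relation.Nullary.Decidable using (Dec; yes; no; does; ¬?; _×-dec_; dec-true; does-⇔)
open import Relation.Nullary.Negation using (¬_; contradiction)
open import Relation.Unary using (Decidable)

open ∑ ℕ.+-*-semiring using (sum; sum-cong-≗; sum-syntax; ∑-distrib-+; ∑-comm; *-distribˡ-sum; *-distribʳ-sum)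

-- Finite sums

∑-const : ∀ n x → ∑[ i < n ] x ≡ n ℕ.* x
∑-const zero    x = refl
∑-const (suc n) x = cong (x ℕ.+_) (∑-const n x)

∑-* : ∀ {m n} (f : Vector ℕ m) (g : Vector ℕ n) →
      ∑[ i < m ] ∑[ j < n ] (f i ℕ.* g j) ≡ sum f ℕ.* sum g
∑-* f g = sym (trans (*-distribʳ-sum (sum g) f) (sum-cong-≗ λ i → *-distribˡ-sum (f i) g))

∑-↑ : ∀ m n (f : Vector ℕ (m ℕ.+ n)) → sum f ≡ ∑[ i < m ] f (i ↑ˡ n) ℕ.+ ∑[ j < n ] f (m ↑ʳ j)
∑-↑ zero    n f = refl
∑-↑ (suc m) n f = trans (cong (f zero ℕ.+_) (∑-↑ m n (f ∘ suc))) (sym (ℕ.+-assoc (f zero) _ _))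

∑-combine : ∀ m n (f : Vector ℕ (m ℕ.* n)) → sum f ≡ ∑[ i < m ] ∑[ j < n ] f (combine i j)
∑-combine zero    n f = refl
∑-combine (suc m) n f = trans (∑-↑ n (m ℕ.* n) f) (cong (∑[ j < n ] f (j ↑ˡ m ℕ.* n) ℕ.+_) (∑-combine m n (f ∘ (n ↑ʳ_))))

sum-tabulate : ∀ {n} (f : Vector ℕ n) → sumᴸ (List.tabulate f) ≡ sum f
sum-tabulate {zero}  f = refl
sum-tabulate {suc n} f = cong (f zero ℕ.+_) (sum-tabulate (f ∘ suc))

-- The Iverson bracket. Its value depends only on the Boolean `does a?`, so equivalent propositions
-- get equal brackets whatever their decision procedures.
⟦_⟧ : ∀ {A : Set} → Dec A → ℕ
⟦ a? ⟧ = if does a? then 1 else 0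

⟦⟧-⇔ : ∀ {A B : Set} → (A → B) → (B → A) → (a? : Dec A) (b? : Dec B) → ⟦ a? ⟧ ≡ ⟦ b? ⟧
⟦⟧-⇔ f g a? b? = cong (if_then 1 else 0) (does-⇔ (mk⇔ f g) a? b?)

⟦⟧-× : ∀ {A B : Set} (a? : Dec A) (b? : Dec B) → ⟦ a? ×-dec b? ⟧ ≡ ⟦ a? ⟧ ℕ.* ⟦ b? ⟧
⟦⟧-× (no _)  b? = refl
⟦⟧-× (yes _) b? = sym (ℕ.+-identityʳ ⟦ b? ⟧)

⟦⟧-¬ : ∀ {A : Set} (a? : Dec A) → ⟦ a? ⟧ ℕ.+ ⟦ ¬? a? ⟧ ≡ 1
⟦⟧-¬ (no _)  = refl
⟦⟧-¬ (yes _) = refl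

length-filter-tabulate : ∀ {n} {A : Set} {P : A → Set} (P? : Decidable P) (f : Fin n → A) →
                         length (filter P? (List.tabulate f)) ≡ ∑[ i < n ] ⟦ P? (f i) ⟧
length-filter-tabulate {zero}  P? f = refl
length-filter-tabulate {suc n} P? f with does (P? (f zero))
... | true  = cong suc (length-filter-tabulate P? (f ∘ suc))
... | false = length-filter-tabulate P? (f ∘ suc)

-- Counting components

unique⇒lookup-injective : ∀ {A : Set} {xs : List A} → Unique xs →
                          ∀ {i j} → List.lookup xs i ≡ List.lookup xs j → i ≡ j
unique⇒lookup-injective (_  ∷ _)  {zero}  {zero}  _  = refl
unique⇒lookup-injective (x≢ ∷ _)  {zero}  {suc j} eq = contradiction eq (All.lookup x≢ (∈-lookup j))
unique⇒lookup-injective (x≢ ∷ _)  {suc i} {zero}  eq = contradiction (sym eq) (All.lookup x≢ (∈-lookup i))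
unique⇒lookup-injective (_  ∷ u)  {suc i} {suc j} eq = cong suc (unique⇒lookup-injective u eq)

-- Pigeonhole: sending each position of `xs` to the position of a related entry of `ys` is
-- injective. A relation replaces a function here so that, with its arguments flipped, it also gives
-- the reverse inequality.
unique⇒length≤ : ∀ {A B : Set} (R : A → B → Set) → (∀ {x x′ y} → R x y → R x′ y → x ≡ x′) →
                 ∀ {xs ys} → Unique xs → (∀ {x} → x ∈ xs → ∃ λ y → y ∈ ys × R x y) →
                 length xs ≤ length ys
unique⇒length≤ R R-injective {xs} {ys} xs! related = injective⇒≤ {f = partner} λ {i} {j} eq →
  unique⇒lookup-injective xs! (R-injective
    (R-partner i) (subst (λ l → R (List.lookup xs j) (List.lookup ys l)) (sym eq) (R-partner j)))
  where
  partner : Fin (length xs) → Fin (length ys)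
  partner i = index (proj₁ (proj₂ (related (∈-lookup i))))

  R-partner : ∀ i → R (List.lookup xs i) (List.lookup ys (partner i))
  R-partner i with related (∈-lookup i)
  ... | y , y∈ys , r = subst (R _) (lookup-index y∈ys) r

module _ {N : ℕ} (G : Graph N) where
  open Graph G

  component-cong : ∀ {u v} → Connected G u v → component G u ≡ component G v
  component-cong {u} {v} p = tabulate-cong λ w →
    does-⇔ (mk⇔ (reverse symm p ◅◅_) (p ◅◅_)) (connected? G u w) (connected? G v w)

  -- The vertex `v` lies in its own component, hence in that of `u`; the entry at `v` in the
  -- component of `u` is the decision of `Connected G u v`, which therefore cannot be negative.
  component-injective : ∀ {u v} → component G u ≡ component G v → Connected G u v
  component-injective {u} {v} eq with connected? G u v in d
  ... | yes p = p
  ... | no ¬p = case trans (sym v∈u) (cong does d) of λ ()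
    where
    v∈u : does (connected? G u v) ≡ true
    v∈u = trans (sym (lookup∘tabulate (does ∘ connected? G u) v))
      (trans (cong (λ S → Vec.lookup S v) eq)
      (trans (lookup∘tabulate (does ∘ connected? G v) v) (dec-true (connected? G v v) ε)))

  -- A label that is constant along edges and separates disconnected vertices is a complete
  -- invariant of components. The relation `Labels` then matches components with labels injectively
  -- in both directions, and each direction yields one inequality.
  length-components : ∀ {B : Set} (label : Fin N → B) →
    (∀ {u v} → Adj u v → label u ≡ label v) →
    (∀ {u v} → label u ≡ label v → Connected G u v) →
    ∀ {labels} → Unique labels →
    (∀ v → label v ∈ labels) → (∀ {b} → b ∈ labels → ∃ λ v → label v ≡ b) →
    length (components G) ≡ length labels
  length-components {B} label adj⇒≡ ≡⇒connected {labels} labels! sound complete = ℕ.≤-antisym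
    (unique⇒length≤ Labels
      (λ { (u , refl , e) (v , refl , e′) → component-cong (≡⇒connected (trans e (sym e′))) })
      (deduplicate-! (≡-dec _≟ᵇ_) (List.map (component G) (allFin N)))
      (λ S∈ → case ∈-map⁻ (component G) (∈-deduplicate⁻ (≡-dec _≟ᵇ_) _ S∈) of λ
        { (v , _ , refl) → label v , sound v , v , refl , refl }))
    (unique⇒length≤ (λ b S → Labels S b)
      (λ { (u , e , refl) (v , e′ , refl) →
           connected⇒≡ (component-injective (trans e (sym e′))) })
      labels!
      (λ b∈ → case complete b∈ of λ
        { (v , e) → component G v
                  , ∈-deduplicate⁺ (≡-dec _≟ᵇ_) (∈-map⁺ (component G) (∈-allFin v))
                  , v , refl , e }))
    where
    Labels : _ → B → Set
    Labels S b = ∃ λ v → component G v ≡ S × label v ≡ b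

    connected⇒≡ : ∀ {u v} → Connected G u v → label u ≡ label v
    connected⇒≡ = gfold label _≡_ (trans ∘ adj⇒≡) refl

-- Blocks of the complete bipartite graph

Hits : ∀ {k N} → Fin k → Coloring k N → Set
Hits c χ = ∃ λ v → c ≡ χ v

hits? : ∀ {k N} (c : Fin k) (χ : Coloring k N) → Dec (Hits c χ)
hits? c χ = any? λ v → c ≟ᶠ χ v

hit miss : ∀ {k N} → Fin k → Coloring k N → ℕ
hit  c χ = ⟦ hits? c χ ⟧
miss c χ = ⟦ ¬? (hits? c χ) ⟧

blockCount : ∀ {k n m} → Coloring k n → Coloring k m → ℕ
blockCount {k} {n} {m} α β =
  ∑[ i < n ] miss (α i) β ℕ.+ (∑[ j < m ] miss (β j) α ℕ.+ ∑[ c < k ] (hit c α ℕ.* hit c β))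

-- Names for the possible blocks: a single vertex of either part, or the set of all vertices of a
-- color that occurs in both parts.
data Label (k n m : ℕ) : Set where
  left   : Fin n → Label k n m
  right  : Fin m → Label k n m
  shared : Fin k → Label k n m

module _ {k n m : ℕ} (χ : Coloring k (n ℕ.+ m)) where

  private
    α : Coloring k n
    α i = χ (i ↑ˡ m)

    β : Coloring k m
    β j = χ (n ↑ʳ j)

    G : Graph (n ℕ.+ m)
    G = monochromatic (K n m) χ

    -- The decision is an explicit argument so that `classify-yes` and `classify-no` can evaluate a
    -- label from a bare proof or refutation.
    classify : {A : Set} → Label k n m → Fin k → Dec A → Label k n m
    classify ℓ c (yes _) = shared c
    classify ℓ c (no _)  = ℓ

    classify-yes : ∀ {A : Set} ℓ c (a? : Dec A) → A → classify ℓ c a? ≡ shared c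
    classify-yes ℓ c (yes _) a = refl
    classify-yes ℓ c (no ¬a) a = contradiction a ¬a

    classify-no : ∀ {A : Set} ℓ c (a? : Dec A) → ¬ A → classify ℓ c a? ≡ ℓ
    classify-no ℓ c (yes a) ¬a = contradiction a ¬a
    classify-no ℓ c (no _)  ¬a = refl

    label⊎ : Fin n ⊎ Fin m → Label k n m
    label⊎ (inj₁ i) = classify (left i)  (α i) (hits? (α i) β)
    label⊎ (inj₂ j) = classify (right j) (β j) (hits? (β j) α)

    label : Fin (n ℕ.+ m) → Label k n m
    label v = label⊎ (splitAt n v)

    label-join : ∀ x → label (join n m x) ≡ label⊎ x
    label-join x = cong label⊎ (splitAt-join n m x)

    -- Each endpoint of a monochromatic edge witnesses that the color of the other occurs in the
    -- opposite part, so both receive the shared label of their common color.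
    opposite⇒≡ : ∀ x y → Opposite x y → χ (join n m x) ≡ χ (join n m y) → label⊎ x ≡ label⊎ y
    opposite⇒≡ (inj₁ i) (inj₂ j) _ e = trans (classify-yes _ _ (hits? (α i) β) (j , e))
      (trans (cong shared e) (sym (classify-yes _ _ (hits? (β j) α) (i , sym e))))
    opposite⇒≡ (inj₂ j) (inj₁ i) _ e = trans (classify-yes _ _ (hits? (β j) α) (i , e))
      (trans (cong shared e) (sym (classify-yes _ _ (hits? (α i) β) (j , sym e))))

    adj⇒≡ : ∀ {u v} → Graph.Adj G u v → label u ≡ label v
    adj⇒≡ {u} {v} (o , e) = opposite⇒≡ (splitAt n u) (splitAt n v) o
      (subst₂ (λ u v → χ u ≡ χ v) (sym (join-splitAt n m u)) (sym (join-splitAt n m v)) e)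

    edge : ∀ x y → Opposite x y → χ (join n m x) ≡ χ (join n m y) → Graph.Adj G (join n m x) (join n m y)
    edge x y o e = subst₂ Opposite (sym (splitAt-join n m x)) (sym (splitAt-join n m y)) o , e

    shared-injective : ∀ {c d} → _≡_ {A = Label k n m} (shared c) (shared d) → c ≡ d
    shared-injective refl = refl

    -- Two vertices of the same part that carry a shared color are joined
    -- through a vertex of the other part.
    ≡⇒connected⊎ : ∀ x y → label⊎ x ≡ label⊎ y → Connected G (join n m x) (join n m y)
    ≡⇒connected⊎ (inj₁ i) (inj₁ i′) eq with hits? (α i) β | hits? (α i′) β
    ... | yes (j , e) | yes _ = edge (inj₁ i) (inj₂ j) tt e
                              ◅ edge (inj₂ j) (inj₁ i′) tt (trans (sym e) (shared-injective eq)) ◅ ε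
    ... | no _ | no _ with refl ← eq = ε
    ≡⇒connected⊎ (inj₁ i) (inj₂ j) eq with hits? (α i) β | hits? (β j) α
    ... | yes _ | yes _ = edge (inj₁ i) (inj₂ j) tt (shared-injective eq) ◅ ε
    ... | yes _ | no _  = case eq of λ ()
    ... | no _  | yes _ = case eq of λ ()
    ... | no _  | no _  = case eq of λ ()
    ≡⇒connected⊎ (inj₂ j) (inj₁ i) eq with hits? (β j) α | hits? (α i) β
    ... | yes _ | yes _ = edge (inj₂ j) (inj₁ i) tt (shared-injective eq) ◅ ε
    ... | yes _ | no _  = case eq of λ ()
    ... | no _  | yes _ = case eq of λ ()
    ... | no _  | no _  = case eq of λ ()
    ≡⇒connected⊎ (inj₂ j) (inj₂ j′) eq with hits? (β j) α | hits? (β j′) α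
    ... | yes (i , e) | yes _ = edge (inj₂ j) (inj₁ i) tt e
                              ◅ edge (inj₁ i) (inj₂ j′) tt (trans (sym e) (shared-injective eq)) ◅ ε
    ... | no _ | no _ with refl ← eq = ε

    ≡⇒connected : ∀ {u v} → label u ≡ label v → Connected G u v
    ≡⇒connected {u} {v} eq = subst₂ (Connected G) (join-splitAt n m u) (join-splitAt n m v)
      (≡⇒connected⊎ (splitAt n u) (splitAt n v) eq)

    missing? : ∀ {n m} (α : Coloring k n) (β : Coloring k m) → Decidable (λ i → ¬ Hits (α i) β)
    missing? α β i = ¬? (hits? (α i) β)

    both? : Decidable (λ c → Hits c α × Hits c β)
    both? c = hits? c α ×-dec hits? c β

    lefts  = filter (missing? α β) (allFin n)
    rights = filter (missing? β α) (allFin m)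
    boths  = filter both? (allFin k)

    -- The labels that are actually attained. The three segments are disjoint because their
    -- constructors differ, and their lengths are the three summands of `blockCount`.
    labels : List (Label k n m)
    labels = List.map left lefts ++ (List.map right rights ++ List.map shared boths)

    labels! : Unique labels
    labels! =
      ++⁺ (map⁺ (λ { refl → refl }) (filter⁺ (missing? α β) (allFin⁺ n)))
          (++⁺ (map⁺ (λ { refl → refl }) (filter⁺ (missing? β α) (allFin⁺ m)))
               (map⁺ shared-injective (filter⁺ both? (allFin⁺ k)))
               λ (r , s) → right≢shared (∈-map⁻ right r) (∈-map⁻ shared s))
          λ (l , rs) → case ∈-++⁻ (List.map right rights) rs of λ
            { (inj₁ r) → left≢right (∈-map⁻ left l) (∈-map⁻ right r)
            ; (inj₂ s) → left≢shared (∈-map⁻ left l) (∈-map⁻ shared s) }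
      where
      right≢shared : ∀ {b js cs} → (∃ λ j → j ∈ js × b ≡ right j) → ¬ (∃ λ c → c ∈ cs × b ≡ shared c)
      right≢shared (_ , _ , refl) (_ , _ , ())

      left≢right : ∀ {b is js} → (∃ λ i → i ∈ is × b ≡ left i) → ¬ (∃ λ j → j ∈ js × b ≡ right j)
      left≢right (_ , _ , refl) (_ , _ , ())

      left≢shared : ∀ {b is cs} → (∃ λ i → i ∈ is × b ≡ left i) → ¬ (∃ λ c → c ∈ cs × b ≡ shared c)
      left≢shared (_ , _ , refl) (_ , _ , ())

    left∈ : ∀ {i} → ¬ Hits (α i) β → left i ∈ labels
    left∈ {i} ¬h = ∈-++⁺ˡ (∈-map⁺ left (∈-filter⁺ (missing? α β) (∈-allFin i) ¬h))

    right∈ : ∀ {j} → ¬ Hits (β j) α → right j ∈ labels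
    right∈ {j} ¬h = ∈-++⁺ʳ (List.map left lefts)
      (∈-++⁺ˡ (∈-map⁺ right (∈-filter⁺ (missing? β α) (∈-allFin j) ¬h)))

    shared∈ : ∀ {c} → Hits c α → Hits c β → shared c ∈ labels
    shared∈ {c} h h′ = ∈-++⁺ʳ (List.map left lefts)
      (∈-++⁺ʳ (List.map right rights) (∈-map⁺ shared (∈-filter⁺ both? (∈-allFin c) (h , h′))))

    sound : ∀ x → label⊎ x ∈ labels
    sound (inj₁ i) with hits? (α i) β
    ... | yes h = shared∈ (i , refl) h
    ... | no ¬h = left∈ ¬h
    sound (inj₂ j) with hits? (β j) α
    ... | yes h = shared∈ h (j , refl)
    ... | no ¬h = right∈ ¬h

    complete : ∀ {b} → b ∈ labels → ∃ λ x → label⊎ x ≡ b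
    complete b∈ with ∈-++⁻ (List.map left lefts) b∈
    ... | inj₁ l with i , i∈ , refl ← ∈-map⁻ left l =
      inj₁ i , classify-no _ _ (hits? (α i) β) (proj₂ (∈-filter⁻ (missing? α β) {xs = allFin n} i∈))
    ... | inj₂ rs with ∈-++⁻ (List.map right rights) rs
    ... | inj₁ r with j , j∈ , refl ← ∈-map⁻ right r =
      inj₂ j , classify-no _ _ (hits? (β j) α) (proj₂ (∈-filter⁻ (missing? β α) {xs = allFin m} j∈))
    -- A color in `boths` occurs on both sides; the vertex carrying it is taken from the first part,
    -- and the occurrence `h` in the second part makes its label shared.
    ... | inj₂ s with c , c∈ , refl ← ∈-map⁻ shared s
                 with (i , refl) , h ← proj₂ (∈-filter⁻ both? {xs = allFin k} c∈) =
      inj₁ i , classify-yes _ _ (hits? (α i) β) h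

    length-labels : length labels ≡ blockCount α β
    length-labels = trans (length-++ (List.map left lefts)) (cong₂ ℕ._+_
      (trans (length-map left lefts) (length-filter-tabulate {n} (missing? α β) id))
      (trans (length-++ (List.map right rights)) (cong₂ ℕ._+_
        (trans (length-map right rights) (length-filter-tabulate {m} (missing? β α) id))
        (trans (length-map shared boths) (trans (length-filter-tabulate {k} both? id)
          (sum-cong-≗ {k} λ c → ⟦⟧-× (hits? c α) (hits? c β)))))))

  X-K : X k (K n m) χ ≡ blockCount (χ ∘ (_↑ˡ m)) (χ ∘ (n ↑ʳ_))
  X-K = trans
    (length-components G label adj⇒≡ ≡⇒connected labels! (sound ∘ splitAt n)
      (λ b∈ → let (x , e) = complete b∈ in join n m x , trans (label-join x) e))
    length-labels

-- Sums over colorings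

-- Summing over the codes in `Fin (k ^ N)` keeps the order of `colorings` and makes the lemmas on
-- finite sums applicable.
∑ᶜ : ∀ {k N} → (Coloring k N → ℕ) → ℕ
∑ᶜ {k} {N} F = ∑[ i < k ℕ.^ N ] F (finToFun i)

-- Decoding a compound code gives the expected coloring only pointwise, so a summand must respect
-- pointwise equality before a sum over colorings can be split.
Extensional : ∀ {k N} → (Coloring k N → ℕ) → Set
Extensional F = ∀ {χ χ′} → χ ≗ χ′ → F χ ≡ F χ′

∷-cong : ∀ {k N} {c d : Fin k} {χ χ′ : Coloring k N} → c ≡ d → χ ≗ χ′ → (c Vector.∷ χ) ≗ (d Vector.∷ χ′)
∷-cong e es zero    = e
∷-cong e es (suc v) = es v

∑ᶜ-cong : ∀ {k N} {F F′ : Coloring k N → ℕ} → (∀ χ → F χ ≡ F′ χ) → ∑ᶜ F ≡ ∑ᶜ F′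
∑ᶜ-cong {k} {N} e = sum-cong-≗ {k ℕ.^ N} λ i → e (finToFun i)

sum-colorings : ∀ {k N} (F : Coloring k N → ℕ) → sumᴸ (List.map F (colorings k N)) ≡ ∑ᶜ F
sum-colorings {k} {N} F = trans
  (cong (sumᴸ ∘ List.map F) (map-tabulate {n = k ℕ.^ N} id finToFun))
  (trans (cong sumᴸ (map-tabulate {n = k ℕ.^ N} finToFun F)) (sum-tabulate {k ℕ.^ N} (F ∘ finToFun)))

-- The code of a coloring of `suc N` vertices is the pair, packed by `combine`, of the color of the
-- first vertex and the code of the remaining coloring.
∑ᶜ-suc : ∀ {k N} {F : Coloring k (suc N) → ℕ} → Extensional F →
         ∑ᶜ F ≡ ∑[ c < k ] ∑ᶜ (λ χ → F (c Vector.∷ χ))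
∑ᶜ-suc {k} {N} {F} F-ext = trans (∑-combine k (k ℕ.^ N) (F ∘ finToFun))
  (sum-cong-≗ {k} λ c → sum-cong-≗ {k ℕ.^ N} λ i → F-ext (finToFun-combine c i))
  where
  finToFun-combine : ∀ (c : Fin k) (i : Fin (k ℕ.^ N)) →
                     finToFun {k} {suc N} (combine c i) ≗ (c Vector.∷ finToFun i)
  finToFun-combine c i zero    = cong proj₁ (remQuot-combine c i)
  finToFun-combine c i (suc v) = cong (λ qr → finToFun (proj₂ qr) v) (remQuot-combine {k} c i)

-- Colorings of the whole graph are pairs of colorings of its parts. Induction on `n` peels off the
-- vertices of the first part one at a time, which avoids identifying codes in `Fin (k ^ (n + m))`
-- with pairs of codes.
∑ᶜ-↑ : ∀ {k} n m {F : Coloring k n → Coloring k m → ℕ} →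
       (∀ {α α′ β β′} → α ≗ α′ → β ≗ β′ → F α β ≡ F α′ β′) →
       ∑ᶜ (λ χ → F (χ ∘ (_↑ˡ m)) (χ ∘ (n ↑ʳ_))) ≡ ∑ᶜ λ α → ∑ᶜ λ β → F α β
-- An empty part has the single coloring `finToFun zero`, so the outer sum on the right is one term
-- plus 0.
∑ᶜ-↑ {k} zero m {F} F-ext = trans
  (∑ᶜ-cong {N = m} λ χ → F-ext {χ ∘ (_↑ˡ m)} {finToFun zero} {χ} (λ ()) (λ _ → refl))
  (sym (ℕ.+-identityʳ (∑ᶜ (F (finToFun zero)))))
∑ᶜ-↑ {k} (suc n) m {F} F-ext = begin
  ∑ᶜ (λ χ → F (χ ∘ (_↑ˡ m)) (χ ∘ (suc n ↑ʳ_)))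
    ≡⟨ ∑ᶜ-suc (λ e → F-ext (e ∘ (_↑ˡ m)) (e ∘ (suc n ↑ʳ_))) ⟩
  ∑[ c < k ] ∑ᶜ (λ χ → F ((c Vector.∷ χ) ∘ (_↑ˡ m)) (χ ∘ (n ↑ʳ_)))
    ≡⟨ (sum-cong-≗ {k} λ c → ∑ᶜ-cong λ χ → F-ext {β = χ ∘ (n ↑ʳ_)} (∷-↑ˡ c χ) (λ _ → refl)) ⟩
  ∑[ c < k ] ∑ᶜ (λ χ → F (c Vector.∷ (χ ∘ (_↑ˡ m))) (χ ∘ (n ↑ʳ_)))
    ≡⟨ (sum-cong-≗ {k} λ c → ∑ᶜ-↑ n m {λ α β → F (c Vector.∷ α) β} (λ e e′ → F-ext (∷-cong refl e) e′)) ⟩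
  ∑[ c < k ] ∑ᶜ (λ α → ∑ᶜ λ β → F (c Vector.∷ α) β)
    ≡⟨ ∑ᶜ-suc {F = λ α → ∑ᶜ (F α)} (λ e → ∑ᶜ-cong λ β → F-ext {β = β} e (λ _ → refl)) ⟨
  ∑ᶜ (λ α → ∑ᶜ λ β → F α β) ∎
  where
  open ≡-Reasoning

  ∷-↑ˡ : ∀ c (χ : Coloring k (n ℕ.+ m)) → ((c Vector.∷ χ) ∘ (_↑ˡ m)) ≗ (c Vector.∷ (χ ∘ (_↑ˡ m)))
  ∷-↑ˡ c χ zero    = refl
  ∷-↑ˡ c χ (suc i) = refl

-- Colorings that hit or miss a given color

Hits-cong : ∀ {k N} {c d : Fin k} {χ χ′ : Coloring k N} → c ≡ d → χ ≗ χ′ → Hits c χ → Hits d χ′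
Hits-cong e es (v , h) = v , trans (sym e) (trans h (es v))

hit-cong : ∀ {k N} {c d : Fin k} {χ χ′ : Coloring k N} → c ≡ d → χ ≗ χ′ → hit c χ ≡ hit d χ′
hit-cong e es = ⟦⟧-⇔ (Hits-cong e es) (Hits-cong (sym e) (sym ∘ es)) (hits? _ _) (hits? _ _)

miss-cong : ∀ {k N} {c d : Fin k} {χ χ′ : Coloring k N} → c ≡ d → χ ≗ χ′ → miss c χ ≡ miss d χ′
miss-cong e es = ⟦⟧-⇔ (_∘ Hits-cong (sym e) (sym ∘ es)) (_∘ Hits-cong e es) (¬? (hits? _ _)) (¬? (hits? _ _))

blockCount-cong : ∀ {k n m} {α α′ : Coloring k n} {β β′ : Coloring k m} →
                  α ≗ α′ → β ≗ β′ → blockCount α β ≡ blockCount α′ β′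
blockCount-cong e e′ = cong₂ ℕ._+_ (sum-cong-≗ λ i → miss-cong (e i) e′)
  (cong₂ ℕ._+_ (sum-cong-≗ λ j → miss-cong (e′ j) e)
               (sum-cong-≗ λ c → cong₂ ℕ._*_ (hit-cong {c = c} refl e) (hit-cong {c = c} refl e′)))

∑-≢ : ∀ {p} (c : Fin (suc p)) → ∑[ d < suc p ] ⟦ ¬? (c ≟ᶠ d) ⟧ ≡ p
∑-≢ {p}     zero    = trans (∑-const p 1) (ℕ.*-identityʳ p)
∑-≢ {suc p} (suc c) = cong suc (∑-≢ c)

-- The search `any?` tests the first vertex before the others, so both sides compute once
-- `does (c ≟ᶠ d)` is known.
miss-∷ : ∀ {k N} (c d : Fin k) (χ : Coloring k N) → miss c (d Vector.∷ χ) ≡ ⟦ ¬? (c ≟ᶠ d) ⟧ ℕ.* miss c χ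
miss-∷ c d χ with does (c ≟ᶠ d)
... | true  = refl
... | false = sym (ℕ.+-identityʳ _)

-- The color of each vertex is chosen independently among the `p` colors other than `c`. By `miss-∷`
-- the sum factors into the choices at the first vertex and those at the rest.
∑ᶜ-miss : ∀ {p} N (c : Fin (suc p)) → ∑ᶜ {N = N} (miss c) ≡ p ℕ.^ N
∑ᶜ-miss     zero    c = refl
∑ᶜ-miss {p} (suc N) c = begin
  ∑ᶜ {N = suc N} (miss c)
    ≡⟨ ∑ᶜ-suc {N = N} (miss-cong {c = c} refl) ⟩
  ∑[ d < suc p ] ∑ᶜ {N = N} (λ χ → miss c (d Vector.∷ χ))
    ≡⟨ (sum-cong-≗ {suc p} λ d → ∑ᶜ-cong {N = N} λ χ → miss-∷ c d χ) ⟩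
  ∑[ d < suc p ] ∑ᶜ {N = N} (λ χ → ⟦ ¬? (c ≟ᶠ d) ⟧ ℕ.* miss c χ)
    ≡⟨ ∑-* {suc p} {suc p ℕ.^ N} (λ d → ⟦ ¬? (c ≟ᶠ d) ⟧) (miss {N = N} c ∘ finToFun) ⟩
  (∑[ d < suc p ] ⟦ ¬? (c ≟ᶠ d) ⟧) ℕ.* ∑ᶜ {N = N} (miss c)
    ≡⟨ cong₂ ℕ._*_ (∑-≢ c) (∑ᶜ-miss N c) ⟩
  p ℕ.* p ℕ.^ N ∎
  where open ≡-Reasoning

-- Every coloring either hits or misses `c`, so this is the complement of `∑ᶜ-miss`. The truncated
-- subtraction is harmless: it removes a summand of the total.
∑ᶜ-hit : ∀ {p} N (c : Fin (suc p)) → ∑ᶜ {N = N} (hit c) ≡ suc p ℕ.^ N ∸ p ℕ.^ N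
∑ᶜ-hit {p} N c = begin
  ∑ᶜ {N = N} (hit c)                                                        ≡⟨ ℕ.m+n∸n≡m _ (∑ᶜ {N = N} (miss c)) ⟨
  ∑ᶜ {N = N} (hit c) ℕ.+ ∑ᶜ {N = N} (miss c) ∸ ∑ᶜ {N = N} (miss c)          ≡⟨ cong₂ _∸_ total (∑ᶜ-miss N c) ⟩
  suc p ℕ.^ N ∸ p ℕ.^ N                                                     ∎
  where
  open ≡-Reasoning

  total : ∑ᶜ {N = N} (hit c) ℕ.+ ∑ᶜ {N = N} (miss c) ≡ suc p ℕ.^ N
  total = trans (sym (∑-distrib-+ {suc p ℕ.^ N} (hit {N = N} c ∘ finToFun) (miss {N = N} c ∘ finToFun)))
    (trans (∑ᶜ-cong {N = N} λ χ → ⟦⟧-¬ (hits? c χ))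
    (trans (∑-const (suc p ℕ.^ N) 1) (ℕ.*-identityʳ _)))

-- The total number of blocks over all colorings

module _ (p : ℕ) where

  private k = suc p

  -- With `α` and a vertex `i` fixed, the number of `β` that miss the color `α i` is `p ^ m`
  -- whatever that color is, so after exchanging sums everything left is constant.
  ∑-isolated : ∀ n m → ∑ᶜ {k} {n} (λ α → ∑ᶜ {k} {m} λ β → ∑[ i < n ] miss (α i) β) ≡ k ℕ.^ n ℕ.* (n ℕ.* p ℕ.^ m)
  ∑-isolated n m = trans
    (∑ᶜ-cong {N = n} λ α → trans
      (∑-comm {k ℕ.^ m} {n} λ b i → miss {N = m} (α i) (finToFun b))
      (trans (sum-cong-≗ {n} λ i → ∑ᶜ-miss m (α i)) (∑-const n (p ℕ.^ m))))
    (∑-const (k ℕ.^ n) (n ℕ.* p ℕ.^ m))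

  -- Once the sum over colors is moved outside, the two parts are independent: for each `c` the
  -- double sum is a product of two hit counts, and neither depends on `c`.
  ∑-shared : ∀ n m → ∑ᶜ {k} {n} (λ α → ∑ᶜ {k} {m} λ β → ∑[ c < k ] (hit c α ℕ.* hit c β)) ≡
             k ℕ.* ((k ℕ.^ n ∸ p ℕ.^ n) ℕ.* (k ℕ.^ m ∸ p ℕ.^ m))
  ∑-shared n m = begin
    ∑ᶜ {k} {n} (λ α → ∑ᶜ {k} {m} λ β → ∑[ c < k ] (hit c α ℕ.* hit c β))
      ≡⟨ (∑ᶜ-cong {N = n} λ α → ∑-comm {k ℕ.^ m} {k} λ b c → hit c α ℕ.* hit {N = m} c (finToFun b)) ⟩
    ∑ᶜ {k} {n} (λ α → ∑[ c < k ] ∑ᶜ {k} {m} λ β → hit c α ℕ.* hit c β)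
      ≡⟨ ∑-comm {k ℕ.^ n} {k} (λ a c → ∑ᶜ {k} {m} λ β → hit {N = n} c (finToFun a) ℕ.* hit c β) ⟩
    ∑[ c < k ] ∑ᶜ {k} {n} (λ α → ∑ᶜ {k} {m} λ β → hit c α ℕ.* hit c β)
      ≡⟨ (sum-cong-≗ {k} λ c → trans
           (∑-* {k ℕ.^ n} {k ℕ.^ m} (hit {N = n} c ∘ finToFun) (hit {N = m} c ∘ finToFun))
           (cong₂ ℕ._*_ (∑ᶜ-hit n c) (∑ᶜ-hit m c))) ⟩
    ∑[ c < k ] ((k ℕ.^ n ∸ p ℕ.^ n) ℕ.* (k ℕ.^ m ∸ p ℕ.^ m))
      ≡⟨ ∑-const k _ ⟩
    k ℕ.* ((k ℕ.^ n ∸ p ℕ.^ n) ℕ.* (k ℕ.^ m ∸ p ℕ.^ m)) ∎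
    where open ≡-Reasoning

  ∑ᶜ-X-K : ∀ n m → ∑ᶜ (X k (K n m)) ≡
    n ℕ.* k ℕ.^ n ℕ.* p ℕ.^ m ℕ.+ m ℕ.* k ℕ.^ m ℕ.* p ℕ.^ n
      ℕ.+ k ℕ.* (k ℕ.^ n ∸ p ℕ.^ n) ℕ.* (k ℕ.^ m ∸ p ℕ.^ m)
  ∑ᶜ-X-K n m = begin
    ∑ᶜ (X k (K n m))
      ≡⟨ ∑ᶜ-cong (X-K {k} {n} {m}) ⟩
    ∑ᶜ (λ χ → blockCount (χ ∘ (_↑ˡ m)) (χ ∘ (n ↑ʳ_)))
      ≡⟨ ∑ᶜ-↑ n m {blockCount} blockCount-cong ⟩
    ∑∑ (λ α β → L α β ℕ.+ (R α β ℕ.+ S α β))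
      ≡⟨ ∑∑-+ L (λ α β → R α β ℕ.+ S α β) ⟩
    ∑∑ L ℕ.+ ∑∑ (λ α β → R α β ℕ.+ S α β)
      ≡⟨ cong (∑∑ L ℕ.+_) (∑∑-+ R S) ⟩
    ∑∑ L ℕ.+ (∑∑ R ℕ.+ ∑∑ S)
      ≡⟨ cong₂ ℕ._+_ (∑-isolated n m) (cong₂ ℕ._+_
           -- Exchanging the sums over `α` and `β` turns the contribution of the second part into
           -- that of the first with `n` and `m` swapped.
           (trans (∑-comm {k ℕ.^ n} {k ℕ.^ m} λ a b → R (finToFun a) (finToFun b)) (∑-isolated m n))
           (∑-shared n m)) ⟩
    k ℕ.^ n ℕ.* (n ℕ.* p ℕ.^ m) ℕ.+ (k ℕ.^ m ℕ.* (m ℕ.* p ℕ.^ n)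
      ℕ.+ k ℕ.* ((k ℕ.^ n ∸ p ℕ.^ n) ℕ.* (k ℕ.^ m ∸ p ℕ.^ m)))
      ≡⟨ rearrange n m k (k ℕ.^ n) (k ℕ.^ m) (p ℕ.^ n) (p ℕ.^ m) (k ℕ.^ n ∸ p ℕ.^ n) (k ℕ.^ m ∸ p ℕ.^ m) ⟩
    _ ∎
    where
    open ≡-Reasoning

    ∑∑ : (Coloring k n → Coloring k m → ℕ) → ℕ
    ∑∑ F = ∑ᶜ λ α → ∑ᶜ λ β → F α β

    ∑∑-+ : ∀ F F′ → ∑∑ (λ α β → F α β ℕ.+ F′ α β) ≡ ∑∑ F ℕ.+ ∑∑ F′
    ∑∑-+ F F′ = trans
      (∑ᶜ-cong {N = n} λ α → ∑-distrib-+ {k ℕ.^ m} (F α ∘ finToFun) (F′ α ∘ finToFun))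
      (∑-distrib-+ {k ℕ.^ n} (∑ᶜ ∘ F ∘ finToFun) (∑ᶜ ∘ F′ ∘ finToFun))

    L R S : Coloring k n → Coloring k m → ℕ
    L α β = ∑[ i < n ] miss (α i) β
    R α β = ∑[ j < m ] miss (β j) α
    S α β = ∑[ c < k ] (hit c α ℕ.* hit c β)

    -- Powers and truncated differences appear as variables, which leaves a plain semiring identity
    -- for the solver.
    rearrange : ∀ n m k kⁿ kᵐ pⁿ pᵐ a b →
      kⁿ ℕ.* (n ℕ.* pᵐ) ℕ.+ (kᵐ ℕ.* (m ℕ.* pⁿ) ℕ.+ k ℕ.* (a ℕ.* b)) ≡
      n ℕ.* kⁿ ℕ.* pᵐ ℕ.+ m ℕ.* kᵐ ℕ.* pⁿ ℕ.+ k ℕ.* a ℕ.* b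
    rearrange = solve-∀

-- Passage from natural numbers to integers

pos-^ : ∀ a n → + (a ℕ.^ n) ≡ (+ a) ^ n
pos-^ a zero    = refl
pos-^ a (suc n) = trans (pos-* a (a ℕ.^ n)) (cong (+ a *_) (pos-^ a n))

pos-∸ : ∀ {a b} → b ≤ a → + (a ∸ b) ≡ + a - + b
pos-∸ {a} {b} b≤a = trans (sym (⊖-≥ b≤a)) (sym (m-n≡m⊖n a b))

-- Powers are monotone in the base, so the truncated difference is the true one.
pos-^∸^ : ∀ p n → + (suc p ℕ.^ n ∸ p ℕ.^ n) ≡ (+ suc p) ^ n - (+ p) ^ n
pos-^∸^ p n = trans (pos-∸ (ℕ.^-monoˡ-≤ n (ℕ.n≤1+n p))) (cong₂ _-_ (pos-^ (suc p) n) (pos-^ p n))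

pos-** : ∀ a b c {y z} → + b ≡ y → + c ≡ z → + (a ℕ.* b ℕ.* c) ≡ + a * y * z
pos-** a b c e e′ = trans (pos-* (a ℕ.* b) c) (cong₂ _*_ (trans (pos-* a b) (cong (+ a *_) e)) e′)

theorem5p1 : (k n m : ℕ) .{{_ : NonZero k}} .{{_ : NonZero n}} .{{_ : NonZero m}} →
    𝔼 (X k (K n m)) ≡
    _/_ (+ n * (+ k) ^ n * (+ k - 1ℤ) ^ m
    + + m * (+ k) ^ m * (+ k - 1ℤ) ^ n
    + + k * ((+ k) ^ n - (+ k - 1ℤ) ^ n) * ((+ k) ^ m - (+ k - 1ℤ) ^ m))
    (k ℕ.^ (n ℕ.+ m)) {{m^n≢0 k (n ℕ.+ m)}}
-- With `k` written as `suc p`, the integer `+ k - 1ℤ` reduces to `+ p`. Both sides have the same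
-- denominator, so only the numerators need to be compared.
theorem5p1 k@(suc p) n m = cong (λ z → _/_ z (k ℕ.^ (n ℕ.+ m)) {{m^n≢0 k (n ℕ.+ m)}})
  (trans (cong +_ (trans (sum-colorings (X k (K n m))) (∑ᶜ-X-K p n m)))
  (cong₂ _+_ (cong₂ _+_ (pos-** n (k ℕ.^ n) (p ℕ.^ m) (pos-^ k n) (pos-^ p m))
                        (pos-** m (k ℕ.^ m) (p ℕ.^ n) (pos-^ k m) (pos-^ p n)))
             (pos-** k _ _ (pos-^∸^ p n) (pos-^∸^ p m))))
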